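{- If $G$ is a $2$-connected graph, then $pc_{1,2}(G)\leq 5$.
   Context: All graphs are finite, undirected, simple and connected. An edge-coloring of a graph is an arbitrary map from its edge set to the natural numbers (adjacent edges may share a color). In an edge-colored graph, a path $P$ is a distance $2$-proper path if no two edges of $P$ of the same color appear with fewer than $2$ edges in between on $P$. The number $pc_{1,2}(G)$ is the minimum number of colors in an edge-coloring of $G$ such that every pair of distinct vertices of $G$ is connected by at least one distance $2$-proper path. -}

module Defs where

open import Data.Fin as Fin using (Fin; zero; suc; toℕ; fromℕ<)
open import Data.Fin.Properties using (any?; all?; toℕ<n; toℕ-fromℕ<; toℕ-injective; toℕ-inject≤;
  inject≤-injective; injective⇒≤)
open import Data.Fin.Subset using (Subset; ∣_∣; _∉_)
open import Data.List using (List; []; _∷_; length; map; filter; zip; drop; head; last; lookup;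
  deduplicate; allFin; cartesianProduct)
open import Data.List.Membership.DecPropositional using (_∈?_)
open import Data.List.Membership.Propositional using (_∈_)
open import Data.List.Membership.Propositional.Properties
  using (∈-map⁺; ∈-map⁻; ∈-filter⁺; ∈-filter⁻; ∈-deduplicate⁺; ∈-deduplicate⁻; ∈-cartesianProduct⁺; ∈-allFin; ∈-lookup)
import Data.List.Membership.Setoid.Properties as Membershipₛ
open import Data.List.Relation.Unary.All as All using (All)
open import Data.List.Relation.Unary.AllPairs using ([]; _∷_)
open import Data.List.Relation.Unary.Any using (here; there; index)
open import Data.List.Relation.Unary.Linked as Linked using (Linked; []; [-]; _∷_)
open import Data.List.Relation.Unary.Unique.Propositional using (Unique)
open import Data.List.Relation.Unary.Unique.DecPropositional using (unique?)
open import Data.List.Relation.Unary.Unique.DecPropositional.Properties using (deduplicate-!)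
open import Data.Maybe using (just)
open import Data.Maybe.Properties using (≡-dec)
open import Data.Nat using (ℕ; zero; suc; _+_; _*_; _∸_; _≤_; _<_; _⊓_; _⊔_; z≤n; s≤s)
open import Data.Nat.Properties as ℕₚ
open import Data.Product using (∃; ∃-syntax; _×_; _,_; proj₁; proj₂; uncurry)
open import Data.Sum using (_⊎_; inj₁; inj₂; [_,_]′)
open import Data.Vec as Vec using (Vec; []; _∷_)
open import Data.Vec.Properties using (lookup∘tabulate)
open import Level using (0ℓ)
open import Relation.Binary using (Rel; Symmetric; Irreflexive; tri<; tri≈; tri>)
import Relation.Binary as B
open import Relation.Binary.PropositionalEquality
open import Relation.Nullary using (Dec; yes; no; ¬_; ¬?; contradiction)
open import Relation.Nullary.Decidable using (map′; _×-dec_; _→-dec_)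
open import Relation.Unary using (Pred; Decidable)

record Graph (n : ℕ) : Set₁ where
  field
    Adj    : Rel (Fin n) 0ℓ
    adj?   : B.Decidable Adj
    symm   : Symmetric Adj
    irrefl : Irreflexive _≡_ Adj

open Graph public

-- A path is given by the list of its vertices, in order.
record IsPath {n} (G : Graph n) (u v : Fin n) (vs : List (Fin n)) : Set where
  field
    starts : head vs ≡ just u
    ends   : last vs ≡ just v
    linked : Linked (Adj G) vs
    unique : Unique vs

open IsPath public

Connected : ∀ {n} → Graph n → Set
Connected G = ∀ u v → ∃ (IsPath G u v)

-- Connectedness of G − X, the graph obtained by deleting the vertices in X.
ConnectedWithout : ∀ {n} → Graph n → Subset n → Set
ConnectedWithout G X =
  ∀ {u v} → u ∉ X → v ∉ X → ∃[ vs ] IsPath G u v vs × All (_∉ X) vs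

KConnected : ∀ {n} → ℕ → Graph n → Set
KConnected {n} k G = k < n × (∀ X → ∣ X ∣ < k → ConnectedWithout G X)

-- The colour of the edge uv is colour u v; the values at non-adjacent pairs
-- are junk and never enter any notion below.
record EdgeColouring {n} (G : Graph n) : Set where
  field
    colour      : Fin n → Fin n → ℕ
    colour-symm : ∀ {u v} → Adj G u v → colour u v ≡ colour v u

open EdgeColouring public

-- Every edge is listed twice, once in each direction.
arcs : ∀ {n} → Graph n → List (Fin n × Fin n)
arcs {n} G = filter (λ (u , v) → adj? G u v) (cartesianProduct (allFin n) (allFin n))

usedColours : ∀ {n} {G : Graph n} → EdgeColouring G → List ℕ
usedColours {G = G} c = deduplicate ℕₚ._≟_ (map (uncurry (colour c)) (arcs G))

numColours : ∀ {n} {G : Graph n} → EdgeColouring G → ℕ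
numColours c = length (usedColours c)

pathEdges : ∀ {n} → List (Fin n) → List (Fin n × Fin n)
pathEdges vs = zip vs (drop 1 vs)

-- Between the i-th and the j-th edge (i < j) there are j ∸ suc i edges.
Distance2Proper : ∀ {n} {G : Graph n} → EdgeColouring G → List (Fin n) → Set
Distance2Proper c vs =
  ∀ i j → i Fin.< j →
  uncurry (colour c) (lookup (pathEdges vs) i) ≡ uncurry (colour c) (lookup (pathEdges vs) j) →
  2 ≤ toℕ j ∸ suc (toℕ i)

Distance2ProperConnected : ∀ {n} {G : Graph n} → EdgeColouring G → Set
Distance2ProperConnected {G = G} c =
  ∀ u v → u ≢ v → ∃[ vs ] IsPath G u v vs × Distance2Proper c vs

IsLeast : Pred ℕ 0ℓ → ℕ → Set
IsLeast P k = P k × (∀ {m} → P m → k ≤ m)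

AchievableWith : ∀ {n} → Graph n → ℕ → Set
AchievableWith G k =
  ∃[ c ] numColours {G = G} c ≡ k × Distance2ProperConnected c

-- The following private lemmas only serve to show that the minimum in the
-- definition of pc₁₂ is attained: the rainbow colouring provides an
-- achievable number of colours, and achievability is decidable because the
-- colours may be renamed to 0, …, k.
private

  least : ∀ {P : Pred ℕ 0ℓ} → Decidable P → ∀ m → P m → ∃ (IsLeast P)
  least P? zero p = zero , p , λ _ → z≤n
  least {P} P? (suc m) p with P? 0
  ... | yes p₀ = zero , p₀ , λ _ → z≤n
  ... | no ¬p₀ with least (λ k → P? (suc k)) m p
  ...   | k , pk , min = suc k , pk , lower
    where
    lower : ∀ {l} → P l → suc k ≤ l
    lower {zero}  q = contradiction q ¬p₀
    lower {suc l} q = s≤s (min q)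

  Searchable : Set → Set₁
  Searchable A = ∀ {P : Pred A 0ℓ} → Decidable P → Dec (∃ P)

  searchVec : ∀ {A} → Searchable A → ∀ n → Searchable (Vec A n)
  searchVec s zero P? = map′ ([] ,_) (λ { ([] , p) → p }) (P? [])
  searchVec s (suc n) P? =
    map′ (λ (x , xs , p) → x ∷ xs , p) (λ { (x ∷ xs , p) → x , xs , p })
      (s λ x → searchVec s n λ xs → P? (x ∷ xs))

  searchList : ∀ {n} m {P : Pred (List (Fin n)) 0ℓ} → Decidable P →
               Dec (∃[ xs ] length xs ≤ m × P xs)
  searchList zero P? = map′ (λ p → [] , z≤n , p) (λ { ([] , _ , p) → p }) (P? [])
  searchList (suc m) P? with P? []
  ... | yes p = yes ([] , z≤n , p)
  ... | no ¬p =
    map′ (λ (x , xs , l , p) → x ∷ xs , s≤s l , p)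
         (λ { ([] , _ , p) → contradiction p ¬p ; (x ∷ xs , s≤s l , p) → x , xs , l , p })
      (any? λ x → searchList m λ xs → P? (x ∷ xs))

  lookup-injective : ∀ {A : Set} {xs : List A} → Unique xs →
                     ∀ i j → lookup xs i ≡ lookup xs j → i ≡ j
  lookup-injective (_ ∷ _) zero zero _ = refl
  lookup-injective (h ∷ _) zero (suc j) eq = contradiction eq (All.lookup h (∈-lookup j))
  lookup-injective (h ∷ _) (suc i) zero eq = contradiction (sym eq) (All.lookup h (∈-lookup i))
  lookup-injective (_ ∷ u) (suc i) (suc j) eq = cong suc (lookup-injective u i j eq)

  length≤n : ∀ {n} {xs : List (Fin n)} → Unique xs → length xs ≤ n
  length≤n u = injective⇒≤ (λ {i} {j} → lookup-injective u i j)

  length≤bound : ∀ {xs : List ℕ} k → Unique xs → (∀ {x} → x ∈ xs → x < k) → length xs ≤ k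
  length≤bound {xs} k u b = injective⇒≤ {f = λ i → fromℕ< (b (∈-lookup i))} λ {i} {j} eq →
    lookup-injective u i j
      (trans (sym (toℕ-fromℕ< _)) (trans (cong toℕ eq) (toℕ-fromℕ< _)))

  isPath? : ∀ {n} (G : Graph n) u v → Decidable (IsPath G u v)
  isPath? G u v vs =
    map′ (λ (s , e , l , q) → record { starts = s ; ends = e ; linked = l ; unique = q })
         (λ p → starts p , ends p , linked p , unique p)
      (≡-dec Fin._≟_ (head vs) (just u) ×-dec ≡-dec Fin._≟_ (last vs) (just v)
        ×-dec Linked.linked? (adj? G) vs ×-dec unique? Fin._≟_ vs)

  distance2Proper? : ∀ {n} {G : Graph n} (c : EdgeColouring G) → Decidable (Distance2Proper c)
  distance2Proper? c vs = all? λ i → all? λ j →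
    (i Fin.<? j) →-dec (_ ℕₚ.≟ _) →-dec (2 ℕₚ.≤? _)

  distance2ProperConnected? : ∀ {n} {G : Graph n} → Decidable (Distance2ProperConnected {G = G})
  distance2ProperConnected? {n} {G} c = all? λ u → all? λ v → ¬? (u Fin.≟ v) →-dec
    map′ (λ (vs , _ , p) → vs , p) (λ (vs , p , d) → vs , length≤n (unique p) , p , d)
      (searchList n λ vs → isPath? G u v vs ×-dec distance2Proper? c vs)

  pathEdge-adj : ∀ {n} {G : Graph n} {vs} → Linked (Adj G) vs →
                 ∀ i → uncurry (Adj G) (lookup (pathEdges vs) i)
  pathEdge-adj (a ∷ l) zero    = a
  pathEdge-adj {G = G} (a ∷ l) (suc i) = pathEdge-adj {G = G} l i

  usedColour : ∀ {n} {G : Graph n} (c : EdgeColouring G) {u v} → Adj G u v →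
               colour c u v ∈ usedColours c
  usedColour {G = G} c {u} {v} a = ∈-deduplicate⁺ ℕₚ._≟_
    (∈-map⁺ (uncurry (colour c))
      (∈-filter⁺ (λ (u , v) → adj? G u v) (∈-cartesianProduct⁺ (∈-allFin u) (∈-allFin v)) a))

  numColours≤ : ∀ {n} {G : Graph n} (c : EdgeColouring G) k →
                (∀ {u v} → Adj G u v → colour c u v < k) → numColours c ≤ k
  numColours≤ {G = G} c k b = length≤bound k
    (deduplicate-! ℕₚ._≟_ (map (uncurry (colour c)) (arcs G))) bound
    where
    bound : ∀ {x} → x ∈ usedColours c → x < k
    bound x∈ with ∈-map⁻ (uncurry (colour c))
                    (∈-deduplicate⁻ ℕₚ._≟_ (map (uncurry (colour c)) (arcs G)) x∈)
    ... | (u , v) , uv∈ , refl = b (proj₂ (∈-filter⁻ (λ (u , v) → adj? G u v)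
            {xs = cartesianProduct (allFin _) (allFin _)} uv∈))

  AchievableWithin : ∀ {n} → Graph n → ℕ → Set
  AchievableWithin G k =
    ∃[ c ] numColours {G = G} c ≤ k × Distance2ProperConnected c

  Matrix : ℕ → ℕ → Set
  Matrix n k = Vec (Vec (Fin (suc k)) n) n

  entry : ∀ {n k} → Matrix n k → Fin n → Fin n → ℕ
  entry M u v = toℕ (Vec.lookup (Vec.lookup M u) v)

  SymmOn : ∀ {n k} → Graph n → Matrix n k → Set
  SymmOn G M = ∀ u v → Adj G u v → entry M u v ≡ entry M v u

  ofMatrix : ∀ {n k} {G : Graph n} (M : Matrix n k) → SymmOn G M → EdgeColouring G
  ofMatrix M s = record { colour = entry M ; colour-symm = s _ _ }

  MatrixAchieves : ∀ {n} (G : Graph n) k → Matrix n k → Set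
  MatrixAchieves G k M = ∃[ s ] numColours {G = G} (ofMatrix M s) ≤ k ×
                                Distance2ProperConnected {G = G} (ofMatrix M s)

  matrixAchieves? : ∀ {n} (G : Graph n) k → Decidable (MatrixAchieves G k)
  matrixAchieves? G k M
    with all? (λ u → all? λ v → adj? G u v →-dec (entry M u v ℕₚ.≟ entry M v u))
  ... | no ¬s = no λ (s , _) → ¬s s
  ... | yes s = map′ (s ,_) proj₂
    ((numColours (ofMatrix {G = G} M s) ℕₚ.≤? k)
      ×-dec distance2ProperConnected? (ofMatrix {G = G} M s))

  rename : ∀ k (xs : List ℕ) → length xs ≤ k → ℕ → Fin (suc k)
  rename k xs l x with _∈?_ ℕₚ._≟_ x xs
  ... | yes p = Fin.inject≤ (index p) (m≤n⇒m≤1+n l)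
  ... | no _  = zero

  rename-< : ∀ k xs l {x} → x ∈ xs → toℕ (rename k xs l x) < length xs
  rename-< k xs l {x} x∈ with _∈?_ ℕₚ._≟_ x xs
  ... | yes p = subst (_< length xs) (sym (toℕ-inject≤ (index p) _)) (toℕ<n (index p))
  ... | no ¬p = contradiction x∈ ¬p

  rename-injective : ∀ k xs l {x y} → x ∈ xs → y ∈ xs →
                     toℕ (rename k xs l x) ≡ toℕ (rename k xs l y) → x ≡ y
  rename-injective k xs l {x} {y} x∈ y∈ eq with _∈?_ ℕₚ._≟_ x xs | _∈?_ ℕₚ._≟_ y xs
  ... | no ¬p | _     = contradiction x∈ ¬p
  ... | yes _ | no ¬q = contradiction y∈ ¬q
  ... | yes p | yes q = Membershipₛ.index-injective (setoid ℕ) p q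
    (inject≤-injective _ _ (index p) (index q) (toℕ-injective eq))

  toMatrix : ∀ {n} {G : Graph n} {k} → AchievableWithin G k → ∃ (MatrixAchieves G k)
  toMatrix {n} {G} {k} (c , l , good) = M , s
    , ≤-trans (numColours≤ c′ (numColours c) λ {u} {v} a →
        subst (_< numColours c) (sym (entry≡ u v)) (rename-< k xs l (usedColour c a))) l
    , λ u v u≢v → let vs , p , d = good u v u≢v in
        vs , p , λ i j i<j eq → d i j i<j
          (rename-injective k xs l
            (usedColour c (pathEdge-adj {G = G} (linked p) i))
            (usedColour c (pathEdge-adj {G = G} (linked p) j))
            (trans (sym (entry≡ _ _)) (trans eq (entry≡ _ _))))
    where
    xs = usedColours c
    f : Fin n → Fin n → Fin (suc k)
    f u v = rename k xs l (colour c u v)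
    M : Matrix n k
    M = Vec.tabulate λ u → Vec.tabulate (f u)
    entry≡ : ∀ u v → entry M u v ≡ toℕ (f u v)
    entry≡ u v = cong toℕ (trans
      (cong (λ r → Vec.lookup r v) (lookup∘tabulate (λ u → Vec.tabulate (f u)) u))
      (lookup∘tabulate (f u) v))
    s : SymmOn G M
    s u v a = trans (entry≡ u v)
      (trans (cong (λ x → toℕ (rename k xs l x)) (colour-symm c a)) (sym (entry≡ v u)))
    c′ : EdgeColouring G
    c′ = ofMatrix M s

  achievableWithin? : ∀ {n} (G : Graph n) → Decidable (AchievableWithin G)
  achievableWithin? {n} G k =
    map′ (λ (M , s , l , good) → ofMatrix M s , l , good) toMatrix
      (searchVec (searchVec any? n) n (matrixAchieves? G k))

  pair : ℕ → ℕ → ℕ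
  pair a b = (a ⊔ b) * (a ⊔ b) + (a ⊓ b)

  square-gap : ∀ {p q p′ q′} → p ≤ q → q < q′ → q * q + p < q′ * q′ + p′
  square-gap {p} {q} {p′} {q′} p≤q q<q′ = begin-strict
    q * q + p        ≤⟨ +-monoʳ-≤ (q * q) p≤q ⟩
    q * q + q        ≡⟨ +-comm (q * q) q ⟩
    suc q * q        <⟨ *-monoʳ-< (suc q) (n<1+n q) ⟩
    suc q * suc q    ≤⟨ *-mono-≤ q<q′ q<q′ ⟩
    q′ * q′          ≤⟨ m≤m+n (q′ * q′) p′ ⟩
    q′ * q′ + p′     ∎
    where open ≤-Reasoning

  pair-injective : ∀ a b c d → pair a b ≡ pair c d → a ⊔ b ≡ c ⊔ d × a ⊓ b ≡ c ⊓ d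
  pair-injective a b c d eq with <-cmp (a ⊔ b) (c ⊔ d)
  ... | tri< lt _ _ = contradiction eq (<⇒≢ (square-gap (m⊓n≤m⊔n a b) lt))
  ... | tri> _ _ gt = contradiction (sym eq) (<⇒≢ (square-gap (m⊓n≤m⊔n c d) gt))
  ... | tri≈ _ e _ = e , +-cancelˡ-≡ ((a ⊔ b) * (a ⊔ b)) _ _
    (trans eq (cong (λ m → m * m + (c ⊓ d)) (sym e)))

  pair-meets : ∀ a b c d → pair a b ≡ pair c d → a ≡ c ⊎ a ≡ d
  pair-meets a b c d eq with pair-injective a b c d eq | ⊔-sel a b | ⊓-sel a b
  ... | e , _ | inj₁ a⊔b≡a | _ =
    [ (λ q → inj₁ (trans (sym a⊔b≡a) (trans e q))) ,
      (λ q → inj₂ (trans (sym a⊔b≡a) (trans e q))) ]′ (⊔-sel c d)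
  ... | _ , e | inj₂ _ | inj₁ a⊓b≡a =
    [ (λ q → inj₁ (trans (sym a⊓b≡a) (trans e q))) ,
      (λ q → inj₂ (trans (sym a⊓b≡a) (trans e q))) ]′ (⊓-sel c d)
  ... | e , _ | inj₂ a⊔b≡b | inj₂ a⊓b≡b =
    [ (λ q → inj₁ (trans a≡a⊔b (trans e q))) ,
      (λ q → inj₂ (trans a≡a⊔b (trans e q))) ]′ (⊔-sel c d)
    where
    a≡a⊔b : a ≡ a ⊔ b
    a≡a⊔b = ≤-antisym (m≤m⊔n a b)
      (subst (_≤ a) (trans a⊓b≡b (sym a⊔b≡b)) (m⊓n≤m a b))

  rainbow : ∀ {n} (G : Graph n) → EdgeColouring G
  rainbow G = record
    { colour      = λ u v → pair (toℕ u) (toℕ v)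
    ; colour-symm = λ {u} {v} _ → cong₂ (λ m k → m * m + k)
                      (⊔-comm (toℕ u) (toℕ v)) (⊓-comm (toℕ u) (toℕ v))
    }

  pathEdge-ends : ∀ {n} (vs : List (Fin n)) i →
                  proj₁ (lookup (pathEdges vs) i) ∈ vs × proj₂ (lookup (pathEdges vs) i) ∈ vs
  pathEdge-ends (x ∷ y ∷ vs) zero    = here refl , there (here refl)
  pathEdge-ends (x ∷ y ∷ vs) (suc i) =
    let p , q = pathEdge-ends (y ∷ vs) i in there p , there q

  rainbow-proper : ∀ {n} (G : Graph n) (vs : List (Fin n)) → Unique vs → Distance2Proper (rainbow G) vs
  rainbow-proper G (x ∷ y ∷ vs) (x∉ ∷ u) zero (suc j) _ eq =
    contradiction (pair-meets (toℕ x) (toℕ y) _ _ eq)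
      [ (λ e → All.lookup x∉ (proj₁ (pathEdge-ends (y ∷ vs) j)) (toℕ-injective e)) ,
        (λ e → All.lookup x∉ (proj₂ (pathEdge-ends (y ∷ vs) j)) (toℕ-injective e)) ]′
  rainbow-proper G (x ∷ y ∷ vs) (_ ∷ u) (suc i) (suc j) (s≤s i<j) eq =
    rainbow-proper G (y ∷ vs) u i j i<j eq

minimum-exists : ∀ {n} (G : Graph n) → Connected G → ∃ (IsLeast (AchievableWith G))
minimum-exists G conn
  with least (achievableWithin? G) (numColours (rainbow G))
         (rainbow G , ≤-refl , λ u v _ →
           let vs , p = conn u v in vs , p , rainbow-proper G vs (unique p))
... | k , (c , l , good) , min =
  k , (c , ≤-antisym l (min (c , ≤-refl , good)) , good)
    , λ (c′ , e , good′) → min (c′ , ≤-reflexive e , good′)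

pc₁₂ : ∀ {n} (G : Graph n) → Connected G → ℕ
pc₁₂ G conn = proj₁ (minimum-exists G conn)

{-# OPTIONS --safe #-}

-- Fix an edge st and order the vertices as in an st-numbering, so that every
-- vertex u has a route to s through vertices ≤ u and a route to t through
-- vertices ≥ u. For u < v the route from u to s, the edge st and the reversed
-- route from v to t form a path, so only the routes have to be coloured well.
-- The order, the routes and the colouring grow together along open ears: an ear
-- a, p₁, …, pₖ, b with a < b is inserted just after a, each pᵢ descending along
-- the ear to a and ascending to b. Its two end edges are coloured first; each
-- inner edge then has to avoid at most two colours on the side of s and two on
-- the side of t, so that five colours suffice. Edges at s on routes to s get
-- colour 1, edges at t on routes to t colour 2, and st colour 0, which makes the
-- junction at st harmless.
module Submission where

open import Defs
open import Data.Bool using (if_then_else_)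
open import Data.Fin as Fin using (Fin; zero; suc; toℕ; #_)
open import Data.Fin.Properties using (any?; injective⇒≤; toℕ-injective)
open import Data.Fin.Subset as Subset using (⁅_⁆)
open import Data.Fin.Subset.Properties using (∣⁅x⁆∣≡1; x≢y⇒x∉⁅y⁆; x∈⁅x⁆)
open import Data.List using (List; []; _∷_; _++_; _ʳ++_; length; map; filter; head; last; lookup;
  take; reverse; allFin)
open import Data.List.Membership.DecPropositional using (_∈?_; _∉?_)
open import Data.List.Membership.Propositional using (_∈_; _∉_)
open import Data.List.Membership.Propositional.Properties
  using (∈-map⁺; ∈-map⁻; ∈-filter⁺; ∈-filter⁻; ∈-deduplicate⁻; ∈-allFin; ∈-lookup)
import Data.List.Membership.Setoid.Properties as Membershipₛ
open import Data.List.Properties using (filter-notAll; length-++; length-take; reverse-++; ++-assoc;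
  ∷-injectiveˡ)
open import Data.List.Relation.Binary.Permutation.Propositional using (↭-sym; ↭⇒↭ₛ)
open import Data.List.Relation.Binary.Permutation.Propositional.Properties
  using (↭-reverse; ∈-resp-↭; All-resp-↭)
import Data.List.Relation.Binary.Permutation.Setoid.Properties as Permutationₛ
open import Data.List.Relation.Binary.Subset.Propositional using (_⊆_)
open import Data.List.Relation.Unary.All as All using (All; []; _∷_)
open import Data.List.Relation.Unary.All.Properties using (++⁻ˡ; ++⁻ʳ; ¬Any⇒All¬; All¬⇒¬Any)
import Data.List.Relation.Unary.All.Properties as Allₚ
open import Data.List.Relation.Unary.AllPairs using ([]; _∷_)
open import Data.List.Relation.Unary.Any as Any using (here; there; index)
open import Data.List.Relation.Unary.Linked as Linked using (Linked; []; [-]; _∷_)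
open import Data.List.Relation.Unary.Unique.DecPropositional.Properties using (deduplicate-!)
open import Data.List.Relation.Unary.Unique.Propositional using (Unique)
open import Data.List.Relation.Unary.Unique.Propositional.Properties using (++⁺; allFin⁺)
open import Data.Maybe using (just)
open import Data.Nat using (ℕ; zero; suc; _*_; _≤_; _<_; z≤n; s≤s; z<s; s<s)
open import Data.Nat.Properties as ℕₚ
open import Data.Product using (∃; ∃-syntax; _×_; _,_; proj₁; proj₂; uncurry; map₂)
open import Data.Sum using (_⊎_; inj₁; inj₂; swap)
open import Data.Unit using (⊤)
open import Function using (_∘_; flip; id; mk⇔)
open import Level using (0ℓ)
open import Relation.Binary using (Rel; tri<; tri≈; tri>)
open import Relation.Binary.PropositionalEquality
open import Relation.Nullary using (Dec; does; yes; no; ¬_; contradiction)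
open import Relation.Nullary.Decidable using (_×-dec_; _⊎-dec_; dec-true; dec-false; does-⇔; decidable-stable)
open import Relation.Unary using (Pred)

-- Lists without repetition

lookup-injective : ∀ {A : Set} {xs : List A} → Unique xs →
                   ∀ i j → lookup xs i ≡ lookup xs j → i ≡ j
lookup-injective (_ ∷ _) zero    zero    _  = refl
lookup-injective (h ∷ _) zero    (suc j) eq = contradiction eq (All.lookup h (∈-lookup j))
lookup-injective (h ∷ _) (suc i) zero    eq = contradiction (sym eq) (All.lookup h (∈-lookup i))
lookup-injective (_ ∷ u) (suc i) (suc j) eq = cong suc (lookup-injective u i j eq)

Unique-⊆⇒length≤ : ∀ {A : Set} {xs ys : List A} → Unique xs → xs ⊆ ys → length xs ≤ length ys
Unique-⊆⇒length≤ {A} {xs} u sub = injective⇒≤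
  {f = λ i → index (sub (∈-lookup {xs = xs} i))} λ {i} {j} eq → lookup-injective u i j
    (Membershipₛ.index-injective (setoid A) (sub (∈-lookup i)) (sub (∈-lookup j)) eq)

-- Colour sequences

Colour : Set
Colour = Fin 5

length-take≤ : ∀ {A : Set} n (xs : List A) → length (take n xs) ≤ n
length-take≤ n xs = ≤-trans (≤-reflexive (length-take n xs)) (m⊓n≤m n _)

-- Otherwise all five colours would occur in a list of length at most four.
fresh : (cs : List Colour) → length cs ≤ 4 → ∃[ e ] All (e ≢_) cs
fresh cs l with any? (λ e → _∉?_ Fin._≟_ e cs)
... | yes (e , e∉) = e , ¬Any⇒All¬ cs e∉
... | no ¬fresh = contradiction
  (Unique-⊆⇒length≤ (allFin⁺ 5) λ {e} _ → decidable-stable (_∈?_ Fin._≟_ e cs) λ e∉ → ¬fresh (e , e∉))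
  (<⇒≱ (s≤s l))

-- Two edges can violate the distance condition only if they are consecutive or have one edge in
-- between, so a colour is compared with the next two.
Clear : Colour → List Colour → Set
Clear e cs = All (e ≢_) (take 2 cs)

data Spaced : List Colour → Set where
  []  : Spaced []
  _∷_ : ∀ {e cs} → Clear e cs → Spaced cs → Spaced (e ∷ cs)

-- The final 0 stands for the edge st, by which every path to s or t may continue.
data Good (tone : Colour) : List Colour → Set where
  []   : Good tone []
  base : Good tone (tone ∷ [])
  _∷_  : ∀ {e d cs} → Clear e (d ∷ cs ++ # 0 ∷ []) → Good tone (d ∷ cs) → Good tone (e ∷ d ∷ cs)

Good-tail : ∀ {r e cs} → Good r (e ∷ cs) → Good r cs
Good-tail base    = []
Good-tail (_ ∷ g) = g

Good-ʳ++⁻ : ∀ {r} xs {ys} → Good r (xs ʳ++ ys) → Good r ys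
Good-ʳ++⁻ []       g = g
Good-ʳ++⁻ (x ∷ xs) g = Good-tail (Good-ʳ++⁻ xs g)

Good-extend : ∀ {r cs} → Good r cs → ∃[ e ] Good r (e ∷ cs)
Good-extend {r} {[]}     g = r , base
Good-extend {r} {d ∷ cs} g =
  let e , e≢ = fresh (take 2 (d ∷ cs ++ # 0 ∷ [])) (≤-trans (length-take≤ 2 (d ∷ cs ++ # 0 ∷ [])) (s≤s (s≤s z≤n)))
  in e , e≢ ∷ g

-- The descending route at an inner vertex of an ear uses only the edges before it,
-- the ascending route only those after it; the two end edges never lie on a common route.
Good-between : ∀ {p q} k {d ds u us} → Good p (d ∷ ds) → Good q (u ∷ us) →
               ∃[ ms ] length ms ≡ k × Good p (ms ʳ++ d ∷ ds) × Good q (ms ++ u ∷ us)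
Good-between zero gd gu = [] , refl , gd , gu
Good-between {p} {q} (suc k) {d} {ds} {u} {us} gd gu
  with e , e≢ ← fresh (take 2 (d ∷ ds ++ # 0 ∷ []) ++ take 2 (u ∷ us ++ # 0 ∷ []))
         (≤-trans (≤-reflexive (length-++ (take 2 (d ∷ ds ++ # 0 ∷ []))))
           (+-mono-≤ (length-take≤ 2 (d ∷ ds ++ # 0 ∷ [])) (length-take≤ 2 (u ∷ us ++ # 0 ∷ []))))
  with ms , l , gd′ , gu′ ← Good-between {p} {q} k
         (++⁻ˡ (take 2 (d ∷ ds ++ # 0 ∷ [])) e≢ ∷ gd) gu
  = e ∷ ms , cong suc l , gd′ , extend ms gd′ gu′
  where
  e≢us : Clear e (u ∷ us ++ # 0 ∷ [])
  e≢us = ++⁻ʳ (take 2 (d ∷ ds ++ # 0 ∷ [])) e≢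

  -- The colours in `ms` are chosen after `e`; that they differ from `e` where needed is read off
  -- the descending sequence.
  extend : ∀ ms → Good p (ms ʳ++ e ∷ d ∷ ds) → Good q (ms ++ u ∷ us) → Good q (e ∷ ms ++ u ∷ us)
  extend [] _ g = e≢us ∷ g
  extend (x ∷ []) ((x≢e ∷ _) ∷ _) g = (≢-sym x≢e ∷ All.head e≢us ∷ []) ∷ g
  extend (x ∷ y ∷ ms) gd g with Good-ʳ++⁻ ms gd
  ... | (_ ∷ y≢e ∷ _) ∷ (x≢e ∷ _) ∷ _ = (≢-sym x≢e ∷ ≢-sym y≢e ∷ []) ∷ g

-- `Good` already accounts for the 0. The only further comparison is between the first colour of
-- `zs` and the last colour of `cs`, which is the tone `r`.
Spaced-++ : ∀ {r cs zs} → Good r cs → r ≢ # 0 → All (r ≢_) (take 1 zs) →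
            Spaced (# 0 ∷ zs) → Spaced (cs ++ # 0 ∷ zs)
Spaced-++ []      r≢0 r≢z s = s
Spaced-++ base    r≢0 r≢z s = (r≢0 ∷ r≢z) ∷ s
Spaced-++ {cs = _ ∷ _ ∷ []}    (e≢ ∷ g) r≢0 r≢z s = e≢ ∷ Spaced-++ g r≢0 r≢z s
Spaced-++ {cs = _ ∷ _ ∷ _ ∷ _} (e≢ ∷ g) r≢0 r≢z s = e≢ ∷ Spaced-++ g r≢0 r≢z s

-- These are the comparisons across the junction when `xs` is reversed in front of `ys`: the first
-- colour of `xs` reaches two places into `ys`, the second one place.
Compatible : List Colour → List Colour → Set
Compatible []       ys = ⊤
Compatible (x ∷ xs) ys = Clear x ys × All (λ x′ → All (x′ ≢_) (take 1 ys)) (take 1 xs)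

Spaced-ʳ++ : ∀ {xs ys} → Spaced xs → Spaced ys → Compatible xs ys → Spaced (xs ʳ++ ys)
Spaced-ʳ++ []       t _ = t
Spaced-ʳ++ (_ ∷ []) t (x≢ , _) = x≢ ∷ t
Spaced-ʳ++ {xs = _ ∷ _ ∷ []} ((x≢x′ ∷ _) ∷ s) t (x≢ , x′≢ ∷ []) =
  Spaced-ʳ++ s (x≢ ∷ t) (≢-sym x≢x′ ∷ x′≢ , [])
Spaced-ʳ++ {xs = _ ∷ _ ∷ _ ∷ _} ((x≢x′ ∷ x≢x″ ∷ []) ∷ s) t (x≢ , x′≢ ∷ []) =
  Spaced-ʳ++ s (x≢ ∷ t) (≢-sym x≢x′ ∷ x′≢ , (≢-sym x≢x″ ∷ []) ∷ [])

Spaced-reverse : ∀ {xs} → Spaced xs → Spaced (reverse xs)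
Spaced-reverse {[]}        s = s
Spaced-reverse {_ ∷ []}    s = Spaced-ʳ++ s [] ([] , [])
Spaced-reverse {_ ∷ _ ∷ _} s = Spaced-ʳ++ s [] ([] , [] ∷ [])

Good-ʳ++-first : ∀ {r e cs} ys → Good r (e ∷ cs) → ∃[ zs ] (e ∷ cs) ʳ++ ys ≡ r ∷ zs
Good-ʳ++-first ys base                = ys , refl
Good-ʳ++-first ys (_∷_ {e = e} _ g) = Good-ʳ++-first (e ∷ ys) g

-- Each half is spaced together with the 0. Across the 0 only the last colours of `ds` and `us`
-- meet; these are the tones, separated by `p ≢ q`.
Good-join : ∀ {p q ds us} → p ≢ # 0 → q ≢ # 0 → p ≢ q → Good p ds → Good q us →
            Spaced (ds ++ # 0 ∷ reverse us)
Good-join {p} {q} {ds} {us} p≢0 q≢0 p≢q gd gu =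
  Spaced-++ gd p≢0 (first us gu)
    (subst Spaced (reverse-++ us (# 0 ∷ [])) (Spaced-reverse (Spaced-++ gu q≢0 [] ([] ∷ []))))
  where
  first : ∀ us → Good q us → All (p ≢_) (take 1 (reverse us))
  first []       _ = []
  first (u ∷ us) g with zs , eq ← Good-ʳ++-first [] g rewrite eq = p≢q ∷ []

-- Colourings and rankings of the vertices

module _ {n : ℕ} where

  Colouring : Set
  Colouring = Fin n → Fin n → Colour

  Symm : Colouring → Set
  Symm c = ∀ x y → c x y ≡ c y x

  colours : Colouring → List (Fin n) → List Colour
  colours c []           = []
  colours c (x ∷ [])     = []
  colours c (x ∷ y ∷ vs) = c x y ∷ colours c (y ∷ vs)

  colours-cong : ∀ {c c′} {P : Pred (Fin n) 0ℓ} → (∀ {x y} → P x → P y → c′ x y ≡ c x y) →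
                 ∀ {vs} → All P vs → colours c′ vs ≡ colours c vs
  colours-cong eq []                 = refl
  colours-cong eq (_ ∷ [])           = refl
  colours-cong eq (px ∷ ps@(py ∷ _)) = cong₂ _∷_ (eq px py) (colours-cong eq ps)

  colours-++ : ∀ c xs {b} vs → colours c (xs ++ b ∷ vs) ≡ colours c (xs ++ b ∷ []) ++ colours c (b ∷ vs)
  colours-++ c []            vs = refl
  colours-++ c (x ∷ [])      vs = refl
  colours-++ c (x ∷ y ∷ xs)  vs = cong (c x y ∷_) (colours-++ c (y ∷ xs) vs)

  colours-ʳ++ : ∀ {c} → Symm c → ∀ {x} xs {y} ys →
                colours c ((x ∷ xs) ʳ++ y ∷ ys) ≡ colours c (x ∷ xs) ʳ++ colours c (x ∷ y ∷ ys)
  colours-ʳ++ s []                ys = refl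
  colours-ʳ++ {c} s {x} (z ∷ xs) {y} ys = trans (colours-ʳ++ s xs (y ∷ ys))
    (cong (λ e → colours c (z ∷ xs) ʳ++ e ∷ c x y ∷ colours c (y ∷ ys)) (s z x))

  colours-reverse : ∀ {c} → Symm c → ∀ xs → colours c (reverse xs) ≡ reverse (colours c xs)
  colours-reverse s []           = refl
  colours-reverse s (x ∷ [])     = refl
  colours-reverse {c} s (x ∷ y ∷ xs) = trans (colours-ʳ++ s xs [])
    (cong (λ e → colours c (y ∷ xs) ʳ++ e ∷ []) (s y x))

  Joins : (u v x y : Fin n) → Set
  Joins u v x y = (x ≡ u × y ≡ v) ⊎ (x ≡ v × y ≡ u)

  joins? : ∀ u v x y → Dec (Joins u v x y)
  joins? u v x y = ((x Fin.≟ u) ×-dec (y Fin.≟ v)) ⊎-dec ((x Fin.≟ v) ×-dec (y Fin.≟ u))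

  recolour : Colouring → (u v : Fin n) → Colour → Colouring
  recolour c u v e x y = if does (joins? u v x y) then e else c x y

  recolour-hit : ∀ c u v e → recolour c u v e u v ≡ e
  recolour-hit c u v e rewrite dec-true (joins? u v u v) (inj₁ (refl , refl)) = refl

  recolour-miss : ∀ c u v e {x y} → ¬ Joins u v x y → recolour c u v e x y ≡ c x y
  recolour-miss c u v e {x} {y} ¬j rewrite dec-false (joins? u v x y) ¬j = refl

  Joins-≢ : ∀ {u v x y : Fin n} → x ≢ u → y ≢ u → ¬ Joins u v x y
  Joins-≢ x≢u y≢u (inj₁ (x≡u , _)) = x≢u x≡u
  Joins-≢ x≢u y≢u (inj₂ (_ , y≡u)) = y≢u y≡u

  Joins-symm : ∀ {u v x y : Fin n} → Joins u v x y → Joins u v y x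
  Joins-symm (inj₁ (p , q)) = inj₂ (q , p)
  Joins-symm (inj₂ (p , q)) = inj₁ (q , p)

  recolour-symm : ∀ {c} u v e → Symm c → Symm (recolour c u v e)
  recolour-symm {c} u v e s x y
    rewrite does-⇔ (mk⇔ Joins-symm Joins-symm) (joins? u v x y) (joins? u v y x) | s x y = refl

  paint : ∀ {c} → Symm c → ∀ a x ps b e ms z → length ms ≡ length ps →
          Unique (a ∷ x ∷ ps) → b ∉ a ∷ x ∷ ps →
          ∃[ c′ ] Symm c′ ×
                  (∀ {y w} → y ∉ x ∷ ps → w ∉ x ∷ ps → c′ y w ≡ c y w) ×
                  colours c′ (a ∷ x ∷ ps) ≡ e ∷ ms ×
                  colours c′ (x ∷ ps ++ b ∷ []) ≡ ms ++ z ∷ []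
  paint {c} s a x [] b e [] z _ ((a≢x ∷ []) ∷ _) b∉ =
      recolour c₁ a x e
    , recolour-symm a x e (recolour-symm x b z s)
    , (λ y∉ w∉ → trans (recolour-miss c₁ a x e (Joins-≢ (y∉ ∘ here) (w∉ ∘ here) ∘ swap))
                       (recolour-miss c x b z (Joins-≢ (y∉ ∘ here) (w∉ ∘ here))))
    , cong (_∷ []) (recolour-hit c₁ a x e)
    , cong (_∷ []) (trans (recolour-miss c₁ a x e (Joins-≢ (≢-sym a≢x) (b∉ ∘ here)))
                          (recolour-hit c x b z))
    where
    c₁ = recolour c x b z
  paint {c} s a x (p ∷ ps) b e (m ∷ ms) z l (a∉ ∷ u) b∉
    with c₁ , s₁ , old , eq₁ , eq₂ ← paint s x p ps b m ms z (suc-injective l) u (b∉ ∘ there)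
    = recolour c₁ a x e
    , recolour-symm a x e s₁
    , (λ y∉ w∉ → trans (recolour-miss c₁ a x e (Joins-≢ (y∉ ∘ here) (w∉ ∘ here) ∘ swap))
                       (old (y∉ ∘ there) (w∉ ∘ there)))
    , cong₂ _∷_ (recolour-hit c₁ a x e)
        (trans (keep (All.map ≢-sym a∉)) eq₁)
    , trans (keep (Allₚ.++⁺ (All.map ≢-sym a∉) ((b∉ ∘ here) ∷ [])))
        (cong₂ _∷_ (∷-injectiveˡ eq₁) eq₂)
    where
    keep : ∀ {vs} → All (_≢ a) vs → colours (recolour c₁ a x e) vs ≡ colours c₁ vs
    keep = colours-cong λ y≢ w≢ → recolour-miss c₁ a x e (Joins-≢ y≢ w≢)

  Injectiveᵣ : (Fin n → ℕ) → Set
  Injectiveᵣ r = ∀ {x y} → r x ≡ r y → x ≡ y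

  -- Doubling makes room for p directly above a.
  insert : (Fin n → ℕ) → (a p : Fin n) → Fin n → ℕ
  insert r a p x = if does (x Fin.≟ p) then suc (2 * r a) else 2 * r x

  insert-new : ∀ r a p → insert r a p p ≡ suc (2 * r a)
  insert-new r a p rewrite dec-true (p Fin.≟ p) refl = refl

  insert-old : ∀ r a p {x} → x ≢ p → insert r a p x ≡ 2 * r x
  insert-old r a p {x} x≢p rewrite dec-false (x Fin.≟ p) x≢p = refl

  insert-injective : ∀ {r} a p → Injectiveᵣ r → Injectiveᵣ (insert r a p)
  insert-injective {r} a p inj {x} {y} eq with x Fin.≟ p | y Fin.≟ p
  ... | yes refl | yes refl = refl
  ... | yes _    | no _     = contradiction (sym eq) (even≢odd (r y) (r a))
  ... | no _     | yes _    = contradiction eq (even≢odd (r x) (r a))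
  ... | no _     | no _     = inj (*-cancelˡ-≡ (r x) (r y) 2 eq)

  Ascending : (Fin n → ℕ) → List (Fin n) → Set
  Ascending r = Linked (λ x y → r x < r y)

  rerank : ∀ {r} → Injectiveᵣ r → ∀ a ps → Unique (a ∷ ps) →
           ∃[ r′ ] Injectiveᵣ r′ ×
                   (∀ {x y} → x ∉ ps → y ∉ ps → r x ≤ r y → r′ x ≤ r′ y) ×
                   (∀ {b} → b ∉ ps → r a < r b → Ascending r′ (a ∷ ps ++ b ∷ []))
  rerank {r} inj a [] _ = r , inj , (λ _ _ → id) , λ _ a<b → a<b ∷ [-]
  rerank {r} inj a (p ∷ ps) ((a≢p ∷ a∉) ∷ u@(p∉ ∷ _))
    with r′ , inj′ , mono , asc ← rerank (insert-injective a p inj) p ps u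
    = r′ , inj′
    , (λ x∉ y∉ x≤y → mono (x∉ ∘ there) (y∉ ∘ there)
        (subst₂ _≤_ (sym (old (x∉ ∘ here))) (sym (old (y∉ ∘ here))) (*-monoʳ-≤ 2 x≤y)))
    , λ b∉ a<b → ≤∧≢⇒< a≤p (a≢p ∘ inj′)
        ∷ asc (b∉ ∘ there) (subst₂ _<_ (sym (insert-new r a p)) (sym (old (b∉ ∘ here))) (odd<even a<b))
    where
    old : ∀ {x} → x ≢ p → insert r a p x ≡ 2 * r x
    old = insert-old r a p
    -- The new vertex has an odd rank just above that of `a`, and `b` has an even one, so the new
    -- vertex is still below `b`.
    odd<even : ∀ {i j} → i < j → suc (2 * i) < 2 * j
    odd<even {i} i<j = ≤-trans (≤-reflexive (sym (*-suc 2 i))) (*-monoʳ-≤ 2 i<j)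
    a≤p : r′ a ≤ r′ p
    a≤p = mono (λ a∈ → All¬⇒¬Any a∉ a∈) (λ p∈ → All¬⇒¬Any p∉ p∈)
      (subst₂ _≤_ (sym (old a≢p)) (sym (insert-new r a p)) (n≤1+n _))

  Ascending-first : ∀ {r a p} ps {zs} → Ascending r (a ∷ ps ++ zs) → p ∈ ps → r a < r p
  Ascending-first (p ∷ ps) (a<p ∷ _)   (here refl) = a<p
  Ascending-first (p ∷ ps) (a<p ∷ asc) (there p∈)  = <-trans a<p (Ascending-first ps asc p∈)

  Ascending-last : ∀ {r b p} ps → Ascending r (ps ++ b ∷ []) → p ∈ ps → r p < r b
  Ascending-last (p ∷ [])     (p<b ∷ _)   (here refl) = p<b
  Ascending-last (p ∷ q ∷ ps) (p<q ∷ asc) (here refl) = <-trans p<q (Ascending-last (q ∷ ps) asc (here refl))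
  Ascending-last (p ∷ ps)     asc         (there p∈)  = Ascending-last ps (Linked.tail asc) p∈

-- Walks and ears

module _ {n : ℕ} (G : Graph n) where

  data Walk : Fin n → Fin n → List (Fin n) → Set where
    [_] : ∀ x → Walk x x (x ∷ [])
    _∷_ : ∀ {x y z vs} → Adj G x y → Walk y z vs → Walk x z (x ∷ vs)

  Walk-uncons : ∀ {x y vs} → Walk x y vs → ∃[ ws ] vs ≡ x ∷ ws
  Walk-uncons [ x ]   = [] , refl
  Walk-uncons (_ ∷ _) = _ , refl

  Walk-first : ∀ {P : Pred (Fin n) 0ℓ} {x y vs} → Walk x y vs → All P vs → P x
  Walk-first [ x ]   (px ∷ _) = px
  Walk-first (_ ∷ _) (px ∷ _) = px

  Walk-++ : ∀ {u v x y us vs} → Walk u x us → Adj G x y → Walk y v vs → Walk u v (us ++ vs)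
  Walk-++ [ x ]   xy q = xy ∷ q
  Walk-++ (e ∷ p) xy q = e ∷ Walk-++ p xy q

  Walk-ʳ++ : ∀ {u v x y us vs} → Walk x u us → Adj G x y → Walk y v vs → Walk u v (us ʳ++ vs)
  Walk-ʳ++ [ x ]   xy q = xy ∷ q
  Walk-ʳ++ (e ∷ p) xy q = Walk-ʳ++ p (symm G e) (xy ∷ q)

  Walk-reverse : ∀ {x y vs} → Walk x y vs → Walk y x (reverse vs)
  Walk-reverse [ x ]   = [ x ]
  Walk-reverse (e ∷ p) = Walk-ʳ++ p (symm G e) [ _ ]

  colours-∷ : ∀ c {p x y vs} → Walk x y vs → colours c (p ∷ vs) ≡ c p x ∷ colours c vs
  colours-∷ c [ _ ]   = refl
  colours-∷ c (_ ∷ _) = refl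

  colours-∷ʳ : ∀ {c} → Symm c → ∀ {p x y vs} → Walk x y vs → colours c (p ∷ vs) ≡ c x p ∷ colours c vs
  colours-∷ʳ {c} s {p} {x} {vs = vs} w = trans (colours-∷ c w) (cong (_∷ colours c vs) (s p x))

  colours-Walk-++ : ∀ c {u v x y us vs} → Walk u x us → Walk y v vs →
                    colours c (us ++ vs) ≡ colours c us ++ c x y ∷ colours c vs
  colours-Walk-++ c [ x ]           q = colours-∷ c q
  colours-Walk-++ c (_ ∷ p@([ _ ])) q = cong (_ ∷_) (colours-Walk-++ c p q)
  colours-Walk-++ c (_ ∷ p@(_ ∷ _)) q = cong (_ ∷_) (colours-Walk-++ c p q)

  Walk⇒IsPath : ∀ {x y vs} → Walk x y vs → Unique vs → IsPath G x y vs
  Walk⇒IsPath p u = record { starts = start p ; ends = end p ; linked = link p ; unique = u }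
    where
    start : ∀ {x y vs} → Walk x y vs → head vs ≡ just x
    start [ x ]   = refl
    start (_ ∷ _) = refl
    end : ∀ {x y vs} → Walk x y vs → last vs ≡ just y
    end [ x ]             = refl
    end (_ ∷ p@([ _ ]))   = end p
    end (_ ∷ p@(_ ∷ _))   = end p
    link : ∀ {x y vs} → Walk x y vs → Linked (Adj G) vs
    link [ x ]             = [-]
    link (e ∷ p@([ _ ]))   = e ∷ link p
    link (e ∷ p@(_ ∷ _))   = e ∷ link p

  IsPath⇒Walk : ∀ {x y vs} → IsPath G x y vs → Walk x y vs
  IsPath⇒Walk p = walk (starts p) (ends p) (linked p)
    where
    walk : ∀ {x y vs} → head vs ≡ just x → last vs ≡ just y → Linked (Adj G) vs → Walk x y vs
    walk refl refl [-]     = [ _ ]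
    walk refl e    (a ∷ l) = a ∷ walk refl e l

  Walk-exit : ∀ {x y vs} out → Walk x y vs → x ∉ out → y ∈ out →
              ∃[ a ] ∃[ p ] Adj G a p × a ∉ out × p ∈ out
  Walk-exit out [ x ] x∉ y∈ = contradiction y∈ x∉
  Walk-exit out (_∷_ {y = z} e p) x∉ y∈ with _∈?_ Fin._≟_ z out
  ... | yes z∈ = _ , z , e , x∉ , z∈
  ... | no z∉  = Walk-exit out p z∉ y∈

  -- Stopping at the first vertex `b` off `out` keeps all earlier vertices in `out`: they become the
  -- interior of an ear ending at `b`.
  Walk-entry : ∀ {x z vs} out → Walk x z vs → x ∈ out → z ∉ out →
               ∃[ y ] ∃[ b ] ∃[ ps ] ∃[ rest ]
                 Walk x y ps × Adj G y b × All (_∈ out) ps × b ∉ out × vs ≡ ps ++ b ∷ rest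
  Walk-entry out [ x ] x∈ z∉ = contradiction x∈ z∉
  Walk-entry out (_∷_ {x} {y} e p) x∈ z∉ with _∈?_ Fin._≟_ y out
  ... | yes y∈ =
    let w , b , ps , rest , q , f , ps⊆ , b∉ , eq = Walk-entry out p y∈ z∉
    in w , b , x ∷ ps , rest , e ∷ q , f , x∈ ∷ ps⊆ , b∉ , cong (x ∷_) eq
  ... | no y∉ =
    let rest , eq = Walk-uncons p
    in x , y , x ∷ [] , rest , [ x ] , e , x∈ ∷ [] , y∉ , cong (x ∷_) eq

  Unique-++⁻ˡ : ∀ xs {ys : List (Fin n)} → Unique (xs ++ ys) → Unique xs
  Unique-++⁻ˡ []       _       = []
  Unique-++⁻ˡ (x ∷ xs) (h ∷ u) = ++⁻ˡ xs h ∷ Unique-++⁻ˡ xs u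

  Unique-reverse : ∀ {xs : List (Fin n)} → Unique xs → Unique (reverse xs)
  Unique-reverse {xs} = Permutationₛ.Unique-resp-↭ (setoid _) (↭⇒↭ₛ (↭-sym (↭-reverse xs)))

  -- Routes to s and t

  -- The relation is abstract so that routes to `s` and routes to `t` are built by the same lemmas.
  -- The bound serves to keep vertices from repeating, both when a route is extended and when two
  -- routes are joined.
  record Route (c : Colouring) (S : Pred (Fin n) 0ℓ) (_⊑_ : Rel (Fin n) 0ℓ) (tone : Colour)
               (root x : Fin n) (vs : List (Fin n)) : Set where
    field
      walk   : Walk x root vs
      unique : Unique vs
      inside : All S vs
      bound  : All (x ⊑_) vs
      good   : Good tone (colours c vs)

  open Route

  Route-map : ∀ {c c′ S S′ _⊑_ _⊑′_ tone root x vs} →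
              (∀ {y z} → S y → S z → c′ y z ≡ c y z) → (∀ {y} → S y → S′ y) →
              (∀ {y z} → S y → S z → y ⊑ z → y ⊑′ z) →
              Route c S _⊑_ tone root x vs → Route c′ S′ _⊑′_ tone root x vs
  Route-map {tone = tone} agree S⊆ ⊑⇒ ρ = record
    { walk   = walk ρ
    ; unique = unique ρ
    ; inside = All.map S⊆ (inside ρ)
    ; bound  = All.zipWith (λ (Sz , y⊑z) → ⊑⇒ (Walk-first (walk ρ) (inside ρ)) Sz y⊑z) (inside ρ , bound ρ)
    ; good   = subst (Good tone) (sym (colours-cong agree (inside ρ))) (good ρ)
    }

  -- Read `a ⊑ w` as: `w` lies on the root's side of `a`. Then `p` lies strictly beyond `a`, and the
  -- bound of a route at `a` excludes `p` from it.
  Step : Rel (Fin n) 0ℓ → Rel (Fin n) 0ℓ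
  Step _⊑_ a p = (∀ w → a ⊑ w → p ⊑ w) × ¬ a ⊑ p

  module _ {c : Colouring {n}} {S : Pred (Fin n) 0ℓ} {_⊑_ : Rel (Fin n) 0ℓ} {tone : Colour}
           {root : Fin n} (⊑-refl : ∀ {x} → x ⊑ x) where

    Route-extend : ∀ {a p vs} → Adj G p a → Step _⊑_ a p → S p → Route c S _⊑_ tone root a vs →
                   Good tone (colours c (p ∷ vs)) → Route c S _⊑_ tone root p (p ∷ vs)
    Route-extend e (down , a⋢p) Sp ρ g = record
      { walk   = e ∷ walk ρ
      ; unique = All.map (λ a⊑w p≡w → a⋢p (subst (_ ⊑_) (sym p≡w) a⊑w)) (bound ρ) ∷ unique ρ
      ; inside = Sp ∷ inside ρ
      ; bound  = ⊑-refl ∷ All.map (down _) (bound ρ)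
      ; good   = g
      }

    -- Here `ps` leads away from the root, so each vertex extends the route of its predecessor, and
    -- the colours along the ear appear reversed. `zs` leaves room for the far end of the ear in the
    -- chain of steps.
    climb : ∀ {a x y ps vs} zs → Symm c → Route c S _⊑_ tone root a vs → Adj G x a → Walk x y ps →
            Linked (Step _⊑_) (a ∷ ps ++ zs) → All S ps → Good tone (colours c (a ∷ ps) ʳ++ colours c vs) →
            ∀ {p} → p ∈ ps → ∃ (Route c S _⊑_ tone root p)
    climb zs s ρ e [ x ] (st ∷ _) (Sx ∷ _) g (here refl) =
      _ , Route-extend e st Sx ρ (subst (Good tone) (sym (colours-∷ʳ s (walk ρ))) g)
    climb {a} {x} {vs = vs} zs s ρ e (_∷_ {y = y} f π) (st ∷ steps) (Sx ∷ Sps) g p∈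
      with ws , refl ← Walk-uncons π = pick p∈
      where
      ρ′ : Route c S _⊑_ tone root x (x ∷ vs)
      ρ′ = Route-extend e st Sx ρ (subst (Good tone) (sym (colours-∷ʳ s (walk ρ)))
             (Good-ʳ++⁻ (colours c (x ∷ y ∷ ws)) g))
      pick : ∀ {p} → p ∈ x ∷ y ∷ ws → ∃ (Route c S _⊑_ tone root p)
      pick (here refl) = _ , ρ′
      pick (there p∈)  = climb zs s ρ′ (symm G f) π steps Sps
        (subst (λ ds → Good tone (colours c (x ∷ y ∷ ws) ʳ++ ds)) (sym (colours-∷ʳ s (walk ρ))) g) p∈

    -- Here `ps` leads towards the root, so each route is a tail of `ps ++ vs`. The route at `x` is
    -- returned separately because the preceding ear vertex extends it.
    descend : ∀ {b x y ps vs} → Walk x y ps → Adj G y b → Route c S _⊑_ tone root b vs →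
              Linked (flip (Step _⊑_)) (ps ++ b ∷ []) → All S ps → Good tone (colours c (ps ++ vs)) →
              Route c S _⊑_ tone root x (ps ++ vs) × (∀ {p} → p ∈ ps → ∃ (Route c S _⊑_ tone root p))
    descend [ x ] e ρ (st ∷ _) (Sx ∷ _) g =
      let ρ′ = Route-extend e st Sx ρ g in ρ′ , λ { (here refl) → _ , ρ′ }
    descend (f ∷ π) e ρ steps (Sx ∷ Sps) g with _ , refl ← Walk-uncons π | st ∷ steps′ ← steps =
      let ρ′ , rest = descend π e ρ steps′ Sps (Good-tail g)
          ρ″ = Route-extend f st Sx ρ′ g
      in ρ″ , λ { (here refl) → _ , ρ″ ; (there p∈) → rest p∈ }

  -- The two bounds and `disjoint` ensure that no vertex repeats; the edge between the roots is the
  -- 0 that `Good` anticipates after either route.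
  Route-join : ∀ {c S S′ _⊑_ _⊑′_ p q root root′ x y us ws} → Symm c →
               Route c S _⊑_ p root x us → Route c S′ _⊑′_ q root′ y ws →
               Adj G root root′ → c root root′ ≡ # 0 → p ≢ # 0 → q ≢ # 0 → p ≢ q →
               (∀ {w} → ¬ (x ⊑ w × y ⊑′ w)) →
               ∃[ vs ] IsPath G x y vs × Spaced (colours c vs)
  Route-join {c} {us = us} {ws} s ρ σ e c≡0 p≢0 q≢0 p≢q disjoint =
      us ++ reverse ws
    , Walk⇒IsPath (Walk-++ (walk ρ) e (Walk-reverse (walk σ)))
        (++⁺ (unique ρ) (Unique-reverse (unique σ)) λ (w∈us , w∈ws) →
          disjoint (All.lookup (bound ρ) w∈us , All.lookup (bound σ) (∈-resp-↭ (↭-reverse ws) w∈ws)))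
    , subst Spaced (sym (trans (colours-Walk-++ c (walk ρ) (Walk-reverse (walk σ)))
          (cong₂ (λ e es → colours c us ++ e ∷ es) c≡0 (colours-reverse s ws))))
        (Good-join p≢0 q≢0 p≢q (good ρ) (good σ))

  -- Growing order, routes and colouring by open ears

  module _ {s t : Fin n} (st : Adj G s t) where

    Down Up : Colouring → (Fin n → ℕ) → List (Fin n) → Fin n → List (Fin n) → Set
    Down c r out = Route c (_∉ out) (λ x w → r w ≤ r x) (# 1) s
    Up   c r out = Route c (_∉ out) (λ x w → r x ≤ r w) (# 2) t

    -- The vertices outside the list out are those already reached by ears.
    record State (out : List (Fin n)) : Set where
      field
        c         : Colouring
        c-symm    : Symm c
        c-st      : c s t ≡ # 0
        s∉        : s ∉ out
        t∉        : t ∉ out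
        r         : Fin n → ℕ
        injective : Injectiveᵣ r
        routes    : ∀ {u v} → u ∉ out → v ∉ out → r u < r v → ∃ (Down c r out u) × ∃ (Up c r out v)

    open State

    without : List (Fin n) → List (Fin n) → List (Fin n)
    without out ps = filter (λ v → _∉?_ Fin._≟_ v ps) out

    ∉-without : ∀ {out ps v} → v ∉ without out ps → v ∈ ps ⊎ v ∉ out
    ∉-without {ps = ps} {v} v∉ with _∈?_ Fin._≟_ v ps
    ... | yes v∈ps = inj₁ v∈ps
    ... | no v∉ps  = inj₂ λ v∈ → v∉ (∈-filter⁺ (λ v → _∉?_ Fin._≟_ v ps) v∈ v∉ps)

    ∈-without⁻ : ∀ {out ps v} → v ∈ without out ps → v ∈ out × v ∉ ps
    ∈-without⁻ {ps = ps} = ∈-filter⁻ (λ v → _∉?_ Fin._≟_ v ps)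

    augment : ∀ {out} (σ : State out) {a b x y ps} → a ∉ out → b ∉ out → r σ a < r σ b →
              Adj G a x → Walk x y ps → Adj G y b → All (_∈ out) ps → Unique ps →
              State (without out ps)
    augment {out} σ {a} {b} {x} {y} {ps} a∉ b∉ a<b e π f ps⊆ u
      with qs , refl ← Walk-uncons π
      with (ds , ρ) , (us , τ) ← routes σ a∉ b∉ a<b
      with us′ , refl ← Walk-uncons (walk τ)
      with e₀ , gd₀ ← Good-extend (good ρ)
      with z , gu₀ ← Good-extend (good τ)
      -- Besides its two end edges, coloured `e₀` and `z`, an ear with `suc (length qs)` inner
      -- vertices has `length qs` edges.
      with ms , l , gd , gu ← Good-between (length qs) gd₀ gu₀
      with c′ , c′-symm , agree , eqd , equ ← paint (c-symm σ) a x qs b e₀ ms z l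
             (All.map (λ p∈ a≡p → a∉ (subst (_∈ out) (sym a≡p) p∈)) ps⊆ ∷ u)
             (λ { (here refl) → <-irrefl refl a<b ; (there b∈) → b∉ (All.lookup ps⊆ b∈) })
      with r′ , inj′ , mono , asc ← rerank (injective σ) a (x ∷ qs)
             (All.map (λ p∈ a≡p → a∉ (subst (_∈ out) (sym a≡p) p∈)) ps⊆ ∷ u)
      = record
      { c         = c′
      ; c-symm    = c′-symm
      ; c-st      = trans (agree (old (s∉ σ)) (old (t∉ σ))) (c-st σ)
      ; s∉        = s∉ σ ∘ proj₁ ∘ ∈-without⁻
      ; t∉        = t∉ σ ∘ proj₁ ∘ ∈-without⁻
      ; r         = r′
      ; injective = inj′
      ; routes    = λ u∉ v∉ → routes′ (∉-without u∉) (∉-without v∉)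
      }
      where
      old : ∀ {v} → v ∉ out → v ∉ ps
      old v∉ v∈ps = v∉ (All.lookup ps⊆ v∈ps)

      keepDown : ∀ {v vs} → Down (c σ) (r σ) out v vs → Down c′ r′ (without out ps) v vs
      keepDown = Route-map (λ y∉ z∉ → agree (old y∉) (old z∉)) (_∘ proj₁ ∘ ∈-without⁻)
        (λ y∉ z∉ → mono (old z∉) (old y∉))

      keepUp : ∀ {v vs} → Up (c σ) (r σ) out v vs → Up c′ r′ (without out ps) v vs
      keepUp = Route-map (λ y∉ z∉ → agree (old y∉) (old z∉)) (_∘ proj₁ ∘ ∈-without⁻)
        (λ y∉ z∉ → mono (old y∉) (old z∉))

      ascending : Ascending r′ (a ∷ ps ++ b ∷ [])
      ascending = asc (old b∉) a<b

      added : All (_∉ without out ps) ps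
      added = All.tabulate λ p∈ p∈′ → proj₂ (∈-without⁻ {out} p∈′) p∈

      reflect : ∀ {v w} → v ∉ out → w ∉ out → r′ v < r′ w → r σ v < r σ w
      reflect v∉ w∉ v<w = ≰⇒> λ w≤v → <⇒≱ v<w (mono (old w∉) (old v∉) w≤v)

      newDown : ∀ {p} → p ∈ ps → ∃ (Down c′ r′ (without out ps) p)
      newDown = climb ≤-refl (b ∷ []) c′-symm (keepDown ρ) (symm G e) π
        (Linked.map (λ q<p → (λ _ w≤q → ≤-trans w≤q (<⇒≤ q<p)) , <⇒≱ q<p) ascending) added
        (subst₂ (λ es es′ → Good (# 1) (es ʳ++ es′)) (sym eqd)
          (sym (colours-cong (λ y∉ z∉ → agree (old y∉) (old z∉)) (inside ρ))) gd)

      newUp : ∀ {p} → p ∈ ps → ∃ (Up c′ r′ (without out ps) p)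
      newUp = proj₂ (descend ≤-refl π f (keepUp τ)
        (Linked.map (λ p<q → (λ _ q≤w → ≤-trans (<⇒≤ p<q) q≤w) , <⇒≱ p<q) (Linked.tail ascending)) added
        (subst (Good (# 2)) (sym (begin
          colours c′ (ps ++ b ∷ us′)                          ≡⟨ colours-++ c′ ps us′ ⟩
          colours c′ (ps ++ b ∷ []) ++ colours c′ (b ∷ us′)
            ≡⟨ cong₂ _++_ equ (colours-cong (λ y∉ z∉ → agree (old y∉) (old z∉)) (inside τ)) ⟩
          (ms ++ z ∷ []) ++ colours (c σ) (b ∷ us′)           ≡⟨ ++-assoc ms (z ∷ []) _ ⟩
          ms ++ z ∷ colours (c σ) (b ∷ us′)                   ∎)) gu))
        where open ≡-Reasoning

      routes′ : ∀ {v w} → v ∈ ps ⊎ v ∉ out → w ∈ ps ⊎ w ∉ out → r′ v < r′ w →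
                ∃ (Down c′ r′ (without out ps) v) × ∃ (Up c′ r′ (without out ps) w)
      routes′ (inj₁ v∈) (inj₁ w∈) v<w = newDown v∈ , newUp w∈
      -- An old vertex above a new one is also above `a`, so its ascending route comes from the old
      -- pair `a`, `w`. The next case uses `b` symmetrically.
      routes′ (inj₁ v∈) (inj₂ w∉) v<w = newDown v∈ , map₂ keepUp (proj₂ (routes σ a∉ w∉
        (reflect a∉ w∉ (<-trans (Ascending-first ps ascending v∈) v<w))))
      routes′ (inj₂ v∉) (inj₁ w∈) v<w = map₂ keepDown (proj₁ (routes σ v∉ b∉
        (reflect v∉ b∉ (<-trans v<w (Ascending-last ps (Linked.tail ascending) w∈))))) , newUp w∈
      routes′ (inj₂ v∉) (inj₂ w∉) v<w =
        let ρ , τ = routes σ v∉ w∉ (reflect v∉ w∉ v<w) in map₂ keepDown ρ , map₂ keepUp τ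

    initial : toℕ s < toℕ t → State (without (allFin n) (s ∷ t ∷ []))
    initial s<t = record
      -- At this stage 0 matters only on `st`; the edges of an ear are recoloured when it is added.
      { c         = λ _ _ → # 0
      ; c-symm    = λ _ _ → refl
      ; c-st      = refl
      ; s∉        = kept (here refl)
      ; t∉        = kept (there (here refl))
      ; r         = toℕ
      ; injective = toℕ-injective
      ; routes    = λ u∉ v∉ → endRoutes (∉-without u∉) (∉-without v∉)
      }
      where
      kept : ∀ {v} → v ∈ s ∷ t ∷ [] → v ∉ without (allFin n) (s ∷ t ∷ [])
      kept v∈ v∈′ = proj₂ (∈-without⁻ {allFin n} v∈′) v∈
      here-route : ∀ {_⊑_ tone} → (∀ {x} → x ⊑ x) → ∀ {v} → v ∈ s ∷ t ∷ [] →
                   ∃ (Route (λ _ _ → # 0) (_∉ without (allFin n) (s ∷ t ∷ [])) _⊑_ tone v v)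
      here-route ⊑-refl v∈ = _ , record
        { walk = [ _ ] ; unique = [] ∷ [] ; inside = kept v∈ ∷ [] ; bound = ⊑-refl ∷ [] ; good = [] }
      -- The only ordered pair is `s` below `t`, for which one-vertex routes suffice. Asking for
      -- routes by ordered pairs thus demands no descending route from `t` and no ascending one from
      -- `s`.
      endRoutes : ∀ {u v} → u ∈ s ∷ t ∷ [] ⊎ u ∉ allFin n → v ∈ s ∷ t ∷ [] ⊎ v ∉ allFin n → toℕ u < toℕ v →
             ∃ (Down (λ _ _ → # 0) toℕ (without (allFin n) (s ∷ t ∷ [])) u) ×
             ∃ (Up (λ _ _ → # 0) toℕ (without (allFin n) (s ∷ t ∷ [])) v)
      endRoutes (inj₂ u∉) _ _ = contradiction (∈-allFin _) u∉
      endRoutes (inj₁ _) (inj₂ v∉) _ = contradiction (∈-allFin _) v∉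
      endRoutes (inj₁ (here refl)) (inj₁ (there (here refl))) _ =
        here-route ≤-refl (here refl) , here-route ≤-refl (there (here refl))
      endRoutes (inj₁ (here refl)) (inj₁ (here refl)) u<v = contradiction u<v (<-irrefl refl)
      endRoutes (inj₁ (there (here refl))) (inj₁ (here refl)) u<v = contradiction u<v (<-asym s<t)
      endRoutes (inj₁ (there (here refl))) (inj₁ (there (here refl))) u<v = contradiction u<v (<-irrefl refl)

    -- Supplies a reached vertex that survives the deletion of `a`, as a target for the ear.
    root-other-than : ∀ {out} → State out → ∀ a → ∃[ z ] z ∉ out × z ≢ a
    root-other-than σ a with s Fin.≟ a
    ... | yes refl = t , t∉ σ , λ t≡s → irrefl G (sym t≡s) st
    ... | no s≢a   = s , s∉ σ , s≢a

    length-without : ∀ {out ps x} → x ∈ out → x ∈ ps → length (without out ps) < length out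
    length-without {out} {ps} x∈ x∈ps =
      filter-notAll (λ v → _∉?_ Fin._≟_ v ps) out (Any.map (λ { refl x∉ → x∉ x∈ps }) x∈)

    -- An edge from a reached `a` to an unreached `x` starts the ear. By 2-connectedness a path
    -- avoiding `a` leads from `x` to a reached vertex; its first reached vertex `b` ends the ear,
    -- which is open because `b` differs from `a`.
    add-ear : Connected G → KConnected 2 G → ∀ {out w} → w ∈ out → State out →
              ∃[ out′ ] length out′ < length out × State out′
    add-ear conn (_ , conn₂) {out} {w} w∈ σ
      with a , x , a-x , a∉ , x∈ ← Walk-exit out (IsPath⇒Walk (proj₂ (conn s w))) (s∉ σ) w∈
      with z , z∉ , z≢a ← root-other-than σ a
      with vs , π , avoids ← conn₂ ⁅ a ⁆ (≤-reflexive (cong suc (∣⁅x⁆∣≡1 a)))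
             (x≢y⇒x∉⁅y⁆ (λ { refl → a∉ x∈ })) (x≢y⇒x∉⁅y⁆ z≢a)
      with y , b , ps , rest , ear , y-b , ps⊆ , b∉ , refl ← Walk-entry out (IsPath⇒Walk π) x∈ z∉
      with <-cmp (r σ a) (r σ b) | Unique-++⁻ˡ ps (unique π) | Walk-uncons ear
    ... | tri< a<b _ _ | ps! | _ , refl =
      _ , length-without x∈ (here refl) , augment σ a∉ b∉ a<b a-x ear y-b ps⊆ ps!
    ... | tri≈ _ a≡b _ | _ | _ =
      contradiction (subst (Subset._∈ ⁅ a ⁆) (injective σ a≡b) (x∈⁅x⁆ a)) (All.head (++⁻ʳ ps avoids))
    -- `augment` takes the lower end first, so the ear is reversed.
    ... | tri> _ _ b<a | ps! | _ , refl =
      _ , length-without x∈ (∈-resp-↭ (↭-sym (↭-reverse ps)) (here refl))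
        , augment σ b∉ a∉ b<a (symm G y-b) (Walk-reverse ear) (symm G a-x)
            (All-resp-↭ (↭-sym (↭-reverse ps)) ps⊆) (Unique-reverse ps!)

    -- `m` is fuel: each ear leaves strictly fewer unreached vertices.
    exhaust : Connected G → KConnected 2 G → ∀ m {out} → length out ≤ m → State out → State []
    exhaust conn conn₂ m       {[]}    _ σ = σ
    exhaust conn conn₂ (suc m) {_ ∷ _} l σ =
      let _ , l′ , σ′ = add-ear conn conn₂ (here refl) σ
      in exhaust conn conn₂ m (≤-pred (≤-trans l′ l)) σ′

    -- The lower vertex uses its route to `s`, which stays at or below its rank, and the higher one
    -- its route to `t`, which stays at or above; hence the two are disjoint.
    connecting-path : (σ : State []) → ∀ u v → u ≢ v → ∃[ vs ] IsPath G u v vs × Spaced (colours (c σ) vs)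
    connecting-path σ u v u≢v with <-cmp (r σ u) (r σ v)
    ... | tri≈ _ eq _ = contradiction (injective σ eq) u≢v
    ... | tri< u<v _ _ =
      let (_ , ρ) , (_ , τ) = routes σ (λ ()) (λ ()) u<v
      in Route-join (c-symm σ) ρ τ st (c-st σ) (λ ()) (λ ()) (λ ())
           λ (w≤u , v≤w) → <⇒≱ u<v (≤-trans v≤w w≤u)
    ... | tri> _ _ v<u =
      let (_ , ρ) , (_ , τ) = routes σ (λ ()) (λ ()) v<u
      in Route-join (c-symm σ) τ ρ (symm G st) (trans (c-symm σ t s) (c-st σ)) (λ ()) (λ ()) (λ ())
           λ (u≤w , w≤v) → <⇒≱ v<u (≤-trans u≤w w≤v)

  -- From spaced colour sequences to the bound

  edgeColouring : (c : Colouring) → Symm c → EdgeColouring G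
  edgeColouring c s = record { colour = λ u v → toℕ (c u v) ; colour-symm = λ _ → cong toℕ (s _ _) }

  numColours≤5 : ∀ c (s : Symm c) → numColours (edgeColouring c s) ≤ 5
  numColours≤5 c s = Unique-⊆⇒length≤ {ys = map toℕ (allFin 5)}
    (deduplicate-! ℕₚ._≟_ (map (uncurry κ) (arcs G))) λ k∈ →
      let (u , v) , _ , eq = ∈-map⁻ (uncurry κ) (∈-deduplicate⁻ ℕₚ._≟_ (map (uncurry κ) (arcs G)) k∈)
      in subst (_∈ map toℕ (allFin 5)) (sym eq) (∈-map⁺ toℕ (∈-allFin (c u v)))
    where κ = colour (edgeColouring c s)

  -- Positions one or two apart are those compared by `Clear`; from three apart on, at least two
  -- edges lie in between.
  Spaced⇒Distance2Proper : ∀ c (s : Symm c) vs → Spaced (colours c vs) →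
                           Distance2Proper (edgeColouring c s) vs
  Spaced⇒Distance2Proper c s (x ∷ y ∷ z ∷ vs) ((≢₁ ∷ _) ∷ _) zero (suc zero) _ eq =
    contradiction (toℕ-injective eq) ≢₁
  Spaced⇒Distance2Proper c s (x ∷ y ∷ z ∷ w ∷ vs) ((_ ∷ ≢₂ ∷ _) ∷ _) zero (suc (suc zero)) _ eq =
    contradiction (toℕ-injective eq) ≢₂
  Spaced⇒Distance2Proper c s (x ∷ y ∷ z ∷ w ∷ vs) _ zero (suc (suc (suc j))) _ _ = s≤s (s≤s z≤n)
  Spaced⇒Distance2Proper c s (x ∷ y ∷ vs) (_ ∷ sp) (suc i) (suc j) (s<s i<j) eq =
    Spaced⇒Distance2Proper c s (y ∷ vs) sp i j i<j eq

  -- Vertex `zero` is taken as `s`, so that any neighbour of it has a larger index.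
  edge : Connected G → 2 < n → ∃[ s ] ∃[ t ] Adj G s t × toℕ s < toℕ t
  edge conn (s<s (s<s z<s)) with conn zero (suc zero)
  ... | _ , π with IsPath⇒Walk π
  ... | _∷_ {y = v} e _ = zero , v , e , n≢0⇒n>0 λ v≡0 → irrefl G (sym (toℕ-injective v≡0)) e

theorem3p1 : ∀ {n : ℕ} (G : Graph n) (conn : Connected G) → KConnected 2 G → pc₁₂ G conn ≤ 5
theorem3p1 G conn conn₂@(2<n , _)
  with s , t , st , s<t ← edge G conn 2<n
  with σ ← exhaust G st conn conn₂ _ ≤-refl (initial G st s<t) =
  -- `κ` achieves exactly the number of colours it uses, so the minimum is at most that number.
  ≤-trans (proj₂ (proj₂ (minimum-exists G conn)) (κ , refl , connected))
    (numColours≤5 G (State.c σ) (State.c-symm σ))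
  where
  open State
  κ = edgeColouring G (c σ) (c-symm σ)
  connected : Distance2ProperConnected κ
  connected u v u≢v =
    let vs , π , sp = connecting-path G st σ u v u≢v
    in vs , π , Spaced⇒Distance2Proper G (c σ) (c-symm σ) vs sp
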